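{- Fix $k \geq 1$. For every morphism $\phi : \mathcal{C}_1 \to \mathcal{C}_2$ of $k$-coloured operads there is a unique operad morphism $\mathrm{E}(\phi) : \mathrm{E}(\mathcal{C}_1) \to \mathrm{E}(\mathcal{C}_2)$ sending the class of $\mathrm{Cor}(x)$ to the class of $\mathrm{Cor}(\phi(x))$ for every $x \in \mathcal{C}_1^+$. With this action on morphisms, $\mathrm{E}$ is a functor from the category of $k$-coloured operads to the category of (non-symmetric, uncoloured) operads. Moreover, if $\phi$ is injective (resp. surjective), then $\mathrm{E}(\phi)$ is injective (resp. surjective).
   Context: All operads are non-symmetric and set-theoretic. A $k$-coloured operad $\mathcal{C}$ is a graded set $\mathcal{C}=\bigsqcup_{n\ge1}\mathcal{C}(n)$ (elements of $\mathcal{C}(n)$ have arity $n$), each $\mathcal{C}(n)$ finite, with maps $\mathrm{Out}$ and $\mathrm{In}_1,\dots,\mathrm{In}_n$ from $\mathcal{C}(n)$ to $[k]=\{1,\dots,k\}$ (output colour and input colours), and partial compositions $x\circ_i y\in\mathcal{C}(|x|+|y|-1)$ defined exactly when $\mathrm{Out}(y)=\mathrm{In}_i(x)$; the output colour of $x\circ_i y$ is $\mathrm{Out}(x)$ and its input colours are those of $x$ with the $i$-th one replaced by the input colours of $y$. These satisfy the usual associativity axioms of operads, and $\mathcal{C}(1)=\{\mathbb{1}_c : c\in[k]\}$ where $\mathbb{1}_c$ has output and input colour $c$ and is a two-sided unit for the compositions in which it can appear. A $1$-coloured operad is an operad. A morphism $\phi:\mathcal{C}_1\to\mathcal{C}_2$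 of $k$-coloured operads is an arity-preserving map such that whenever $x\circ_i y$ is defined in $\mathcal{C}_1$, then $\phi(x)\circ_i\phi(y)$ is defined in $\mathcal{C}_2$ and equals $\phi(x\circ_i y)$. Let $\mathcal{C}^+=\mathcal{C}\setminus\mathcal{C}(1)$. Let $\mathcal{F}$ be the free (uncoloured) operad generated by the graded set $\mathcal{C}^+$ (colours forgotten). Its elements are planar rooted trees whose internal nodes with $\ell$ children are labelled by elements of $\mathcal{C}^+(\ell)$, and its composition $S\circ_i T$ grafts the root of $T$ onto the $i$-th leaf of $S$. Let $\mathrm{Cor}(x)$ be the tree with a single internal node, labelled $x$. The enveloping operad is $\mathrm{E}(\mathcal{C}):=\mathcal{F}/_{\equiv}$, where $\equiv$ is the smallest operad congruence of $\mathcal{F}$ such that $\mathrm{Cor}(x)\circ_i\mathrm{Cor}(y)\equiv\mathrm{Cor}(x\circ_i y)$ for all $x,y\in\mathcal{C}^+$ for which $x\circ_i y$ is defined in $\mathcal{C}$. -}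

module Defs where

open import Data.Nat using (ℕ; zero; suc; _+_; _∸_; _≤_; _<_; _<ᵇ_)
open import Data.Nat.Properties using (<-irrelevant)
open import Data.Fin using (Fin)
open import Data.Vec using (Vec; []; _∷_; replicate)
open import Data.Product using (Σ; _,_; proj₁; proj₂)
open import Data.Bool using (if_then_else_)
open import Function.Bundles using (_↔_)
open import Relation.Binary.PropositionalEquality using (_≡_; refl; trans; cong; subst; sym)

-- k-coloured operads (non-symmetric, set-theoretic).
-- The graded set C = ⊔_{n ≥ 1} C(n) is encoded as a carrier together
-- with an arity function; C(n) = { x | arity x ≡ n }.
-- Input positions are natural numbers i with i < arity x (0-based).
-- The partial composition x ∘_i y is a function that takes as extra
-- argument a proof that it is defined, i.e. Out(y) ≡ In_i(x).

record ColouredOperad (k : ℕ) : Set₁ where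
  field
    Carrier : Set
    arity   : Carrier → ℕ
    arity-pos : ∀ x → 1 ≤ arity x
    finite  : ∀ n → Σ ℕ (λ m → (Σ Carrier (λ x → arity x ≡ n)) ↔ Fin m)
    out     : Carrier → Fin k
    inp     : (x : Carrier) (i : ℕ) → i < arity x → Fin k
    comp    : (x : Carrier) (i : ℕ) (p : i < arity x) (y : Carrier) →
              out y ≡ inp x i p → Carrier
    comp-arity : ∀ x i p y q → arity (comp x i p y q) ≡ arity x + arity y ∸ 1
    comp-out   : ∀ x i p y q → out (comp x i p y q) ≡ out x
    comp-inp-before : ∀ x i p y q j (r : j < arity (comp x i p y q)) (s : j < arity x) →
              j < i → inp (comp x i p y q) j r ≡ inp x j s
    comp-inp-middle : ∀ x i p y q l (r : i + l < arity (comp x i p y q)) (s : l < arity y) →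
              inp (comp x i p y q) (i + l) r ≡ inp y l s
    comp-inp-after : ∀ x i p y q j (r : j + arity y ∸ 1 < arity (comp x i p y q))
              (s : j < arity x) → i < j →
              inp (comp x i p y q) (j + arity y ∸ 1) r ≡ inp x j s
    assoc-seq : ∀ x i p y q j r z s p' t u v →
              comp (comp x i p y q) (i + j) r z s ≡ comp x i p' (comp y j t z u) v
    assoc-par : ∀ x i p y q j r z s p' t u v → i < j →
              comp (comp x i p y q) (j + arity y ∸ 1) r z s ≡ comp (comp x j p' z t) i u y v
    unit       : Fin k → Carrier
    unit-arity : ∀ c → arity (unit c) ≡ 1
    unit-out   : ∀ c → out (unit c) ≡ c
    unit-inp   : ∀ c p → inp (unit c) 0 p ≡ c
    only-units : ∀ x → arity x ≡ 1 → Σ (Fin k) (λ c → x ≡ unit c)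
    unit-left  : ∀ c p y q → comp (unit c) 0 p y q ≡ y
    unit-right : ∀ x i p c q → comp x i p (unit c) q ≡ x

-- Morphisms of k-coloured operads (as in the paper: arity preserving,
-- and whenever x ∘_i y is defined, φ x ∘_i φ y is defined and equals
-- φ (x ∘_i y)).  Colours need not be preserved.

record Morphism {k : ℕ} (C₁ C₂ : ColouredOperad k) : Set where
  private
    module A = ColouredOperad C₁
    module B = ColouredOperad C₂
  field
    fun       : A.Carrier → B.Carrier
    fun-arity : ∀ x → B.arity (fun x) ≡ A.arity x
    fun-comp  : ∀ x i p y q (p' : i < B.arity (fun x)) →
                Σ (B.out (fun y) ≡ B.inp (fun x) i p')
                  (λ q' → fun (A.comp x i p y q) ≡ B.comp (fun x) i p' (fun y) q')

open Morphism public

idMorphism : ∀ {k} (C : ColouredOperad k) → Morphism C C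
idMorphism C = record { fun = λ x → x ; fun-arity = λ _ → refl ; fun-comp = fc }
  where
  open ColouredOperad C
  fc : ∀ x i p y q (p' : i < arity x) →
       Σ (out y ≡ inp x i p') (λ q' → comp x i p y q ≡ comp x i p' y q')
  fc x i p y q p' with <-irrelevant p p'
  ... | refl = q , refl

_∘M_ : ∀ {k} {C₁ C₂ C₃ : ColouredOperad k} → Morphism C₂ C₃ → Morphism C₁ C₂ → Morphism C₁ C₃
_∘M_ {C₁ = C₁} {C₂} {C₃} ψ φ = record
  { fun = λ x → fun ψ (fun φ x)
  ; fun-arity = λ x → trans (fun-arity ψ (fun φ x)) (fun-arity φ x)
  ; fun-comp = fc }
  where
  module B = ColouredOperad C₂
  fc : _
  fc x i p y q p'' =
    let p' : i < B.arity (fun φ x)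
        p' = subst (i <_) (sym (fun-arity φ x)) p
        r₁ = fun-comp φ x i p y q p'
        r₂ = fun-comp ψ (fun φ x) i p' (fun φ y) (proj₁ r₁) p''
    in proj₁ r₂ , trans (cong (fun ψ) (proj₂ r₁)) (proj₂ r₂)

InjectiveMor : ∀ {k} {C₁ C₂ : ColouredOperad k} → Morphism C₁ C₂ → Set
InjectiveMor φ = ∀ x y → fun φ x ≡ fun φ y → x ≡ y

SurjectiveMor : ∀ {k} {C₁ C₂ : ColouredOperad k} → Morphism C₁ C₂ → Set
SurjectiveMor {C₂ = C₂} φ = ∀ y → Σ _ (λ x → fun φ x ≡ y)

-- The free operad F on C⁺ = C ∖ C(1): planar rooted trees whose internal
-- nodes with ℓ children are labelled by elements of arity ℓ ≥ 2.

module _ {k : ℕ} (C : ColouredOperad k) where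
  open ColouredOperad C

  data Tree : Set where
    leaf : Tree
    node : (x : Carrier) → .(2 ≤ arity x) → Vec Tree (arity x) → Tree

  mutual
    arityT : Tree → ℕ
    arityT leaf = 1
    arityT (node x _ ts) = arityTs ts

    arityTs : ∀ {n} → Vec Tree n → ℕ
    arityTs [] = 0
    arityTs (t ∷ ts) = arityT t + arityTs ts

  -- grafting: S ∘_i T grafts the root of T onto the i-th leaf (0-based) of S
  -- (only meaningful for i < arityT S)
  mutual
    graft : Tree → ℕ → Tree → Tree
    graft leaf zero T = T
    graft leaf (suc i) T = leaf
    graft (node x p ts) i T = node x p (graftTs ts i T)

    graftTs : ∀ {n} → Vec Tree n → ℕ → Tree → Vec Tree n
    graftTs [] i T = []
    graftTs (t ∷ ts) i T =
      if i <ᵇ arityT t then graft t i T ∷ ts else t ∷ graftTs ts (i ∸ arityT t) T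

  Cor : (x : Carrier) → .(2 ≤ arity x) → Tree
  Cor x p = node x p (replicate (arity x) leaf)

  -- the smallest operad congruence ≡ on F with Cor x ∘_i Cor y ≡ Cor (x ∘_i y)
  -- (x, y ∈ C⁺, x ∘_i y defined in C); the enveloping operad E(C) is F/≡,
  -- represented as the setoid (Tree, _≈E_).
  data _≈E_ : Tree → Tree → Set where
    ≈-base  : ∀ x (px : 2 ≤ arity x) y (py : 2 ≤ arity y) i p q
                (pxy : 2 ≤ arity (comp x i p y q)) →
              graft (Cor x px) i (Cor y py) ≈E Cor (comp x i p y q) pxy
    ≈-refl  : ∀ {S} → S ≈E S
    ≈-sym   : ∀ {S T} → S ≈E T → T ≈E S
    ≈-trans : ∀ {S T U} → S ≈E T → T ≈E U → S ≈E U
    ≈-graft : ∀ {S S' T T'} i → i < arityT S → S ≈E S' → T ≈E T' →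
              graft S i T ≈E graft S' i T'

-- Operad morphisms E(C₁) → E(C₂), represented on representatives.

module _ {k : ℕ} {C₁ C₂ : ColouredOperad k} where
  private
    module A = ColouredOperad C₁
    module B = ColouredOperad C₂

  record IsEnvMorphism (F : Tree C₁ → Tree C₂) : Set where
    field
      resp      : ∀ {S T} → _≈E_ C₁ S T → _≈E_ C₂ (F S) (F T)
      pres-arity : ∀ S → arityT C₂ (F S) ≡ arityT C₁ S
      pres-graft : ∀ S i → i < arityT C₁ S → ∀ T →
                   _≈E_ C₂ (F (graft C₁ S i T)) (graft C₂ (F S) i (F T))

  SendsCor : Morphism C₁ C₂ → (Tree C₁ → Tree C₂) → Set
  SendsCor φ F = ∀ x (p : 2 ≤ A.arity x) (p' : 2 ≤ B.arity (fun φ x)) →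
                 _≈E_ C₂ (F (Cor C₁ x p)) (Cor C₂ (fun φ x) p')

  InjectiveEnv : (Tree C₁ → Tree C₂) → Set
  InjectiveEnv F = ∀ S T → _≈E_ C₂ (F S) (F T) → _≈E_ C₁ S T

  SurjectiveEnv : (Tree C₁ → Tree C₂) → Set
  SurjectiveEnv F = ∀ T → Σ (Tree C₁) (λ S → _≈E_ C₂ (F S) T)

{-# OPTIONS --safe #-}
module Submission where

-- A morphism relabels trees node by node; since trees are generated by corollas under
-- grafting, it is the only possible E(φ), which gives functoriality as well.
--
-- Injectivity rests on normal forms.  Contracting every edge whose two ends have matching
-- colours turns trees over C into an algebra over the free operad: a node labelled x absorbs
-- each child whose root has the output colour required by x.  By the associativity axioms this
-- operation satisfies the relations Cor(x) ∘ᵢ Cor(y) ≡ Cor(x ∘ᵢ y), so evaluation at trivial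
-- leaves is constant on congruence classes, and each tree is congruent to its value.
-- An injective φ permutes the colours, hence preserves and reflects the matching of colours,
-- so it commutes with taking normal forms.

open import Defs
open import Axiom.UniquenessOfIdentityProofs.WithK using (uip)
open import Data.Bool as Bool using (true; false)
open import Data.Empty using (⊥-elim)
open import Data.Fin using (Fin)
import Data.Fin.Properties as Fin
open import Data.List using (List; []; _∷_; _++_; length; map; applyUpTo; replicate)
open import Data.List.Properties
  using (∷-injectiveˡ; ∷-injectiveʳ; ++-assoc; length-++; map-++; length-replicate;
         length-applyUpTo)
open import Data.List.Relation.Binary.Pointwise using (Pointwise; []; _∷_; Pointwise-length)
open import Data.List.Relation.Unary.All using (All; []; _∷_; universal)
open import Data.List.Relation.Unary.All.Properties using (++⁺)
open import Data.Nat
open import Data.Nat.ListAction using (sum)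
open import Data.Nat.ListAction.Properties using (sum-++)
open import Data.Nat.Properties
open import Data.Product using (Σ; ∃; _×_; _,_; proj₁; proj₂)
open import Data.Sum using (_⊎_; inj₁; inj₂)
open import Data.Unit using (⊤; tt)
open import Data.Vec as Vec using (Vec; []; _∷_; toList)
open import Data.Vec.Properties using (length-toList)
open import Function using (_∘_; id)
open import Relation.Binary.PropositionalEquality
open import Relation.Nullary using (Dec; yes; no; ¬_; contradiction)
open import Relation.Nullary.Decidable using (recompute)

below-or-above : ∀ n i → i < n ⊎ ∃ λ j → n + j ≡ i
below-or-above n i with i <? n
... | yes i<n = inj₁ i<n
... | no  i≮n = inj₂ (m≤n⇒∃[o]m+o≡n (≮⇒≥ i≮n))

-- Arity and grafting of trees.

module Trees {k : ℕ} (C : ColouredOperad k) where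
  open ColouredOperad C

  𝕋 : Set
  𝕋 = Tree C

  infix 4 _≈_
  _≈_ : 𝕋 → 𝕋 → Set
  _≈_ = _≈E_ C

  ∣_∣ : 𝕋 → ℕ
  ∣_∣ = arityT C

  ≈-reflexive : ∀ {S T} → S ≡ T → S ≈ T
  ≈-reflexive refl = ≈-refl

  graftTs-here : ∀ {n} t (ts : Vec 𝕋 n) {i} T → i < ∣ t ∣ →
                 graftTs C (t ∷ ts) i T ≡ graft C t i T ∷ ts
  graftTs-here t ts {i} T r with i <ᵇ ∣ t ∣ | <⇒<ᵇ r
  ... | true | _ = refl

  graftTs-there : ∀ {n} t (ts : Vec 𝕋 n) i T →
                  graftTs C (t ∷ ts) (∣ t ∣ + i) T ≡ t ∷ graftTs C ts i T
  graftTs-there t ts i T with (∣ t ∣ + i) <ᵇ ∣ t ∣ in eq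
  ... | true  = ⊥-elim (m+n≮m ∣ t ∣ i (<ᵇ⇒< _ _ (subst Bool.T (sym eq) tt)))
  ... | false = cong (λ j → t ∷ graftTs C ts j T) (m+n∸m≡n ∣ t ∣ i)

  mutual
    -- Adding one on the left keeps the count free of truncated subtraction.
    arity-graft : ∀ S {i} T → i < ∣ S ∣ → suc ∣ graft C S i T ∣ ≡ ∣ S ∣ + ∣ T ∣
    arity-graft leaf {zero} T _ = refl
    arity-graft leaf {suc i} T (s≤s ())
    arity-graft (node x p ts) T r = arity-graftTs ts T r

    arity-graftTs : ∀ {n} (ts : Vec 𝕋 n) {i} T → i < arityTs C ts →
                    suc (arityTs C (graftTs C ts i T)) ≡ arityTs C ts + ∣ T ∣
    arity-graftTs (t ∷ ts) {i} T r with below-or-above ∣ t ∣ i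
    ... | inj₁ i<t rewrite graftTs-here t ts T i<t = begin
      suc ∣ graft C t i T ∣ + arityTs C ts  ≡⟨ cong (_+ arityTs C ts) (arity-graft t T i<t) ⟩
      ∣ t ∣ + ∣ T ∣ + arityTs C ts          ≡⟨ +-assoc ∣ t ∣ _ _ ⟩
      ∣ t ∣ + (∣ T ∣ + arityTs C ts)        ≡⟨ cong (∣ t ∣ +_) (+-comm ∣ T ∣ _) ⟩
      ∣ t ∣ + (arityTs C ts + ∣ T ∣)        ≡⟨ +-assoc ∣ t ∣ _ _ ⟨
      ∣ t ∣ + arityTs C ts + ∣ T ∣          ∎ where open ≡-Reasoning
    ... | inj₂ (j , refl) rewrite graftTs-there t ts j T = begin
      suc (∣ t ∣ + arityTs C (graftTs C ts j T))  ≡⟨ +-suc ∣ t ∣ _ ⟨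
      ∣ t ∣ + suc (arityTs C (graftTs C ts j T))  ≡⟨ cong (∣ t ∣ +_) (arity-graftTs ts T (+-cancelˡ-< ∣ t ∣ _ _ r)) ⟩
      ∣ t ∣ + (arityTs C ts + ∣ T ∣)              ≡⟨ +-assoc ∣ t ∣ _ _ ⟨
      ∣ t ∣ + arityTs C ts + ∣ T ∣                ∎ where open ≡-Reasoning

  arityTs-leaves : ∀ n → arityTs C (Vec.replicate n leaf) ≡ n
  arityTs-leaves zero    = refl
  arityTs-leaves (suc n) = cong suc (arityTs-leaves n)

  -- Grafting is constrained by a bound on its index; this carries such bounds from one side of a
  -- congruence to the other.
  arity-resp : ∀ {S T} → S ≈ T → ∣ S ∣ ≡ ∣ T ∣
  arity-resp (≈-base x px y py i p q pxy) = suc-injective (begin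
    suc ∣ graft C (Cor C x px) i (Cor C y py) ∣
      ≡⟨ arity-graft (Cor C x px) (Cor C y py) (subst (i <_) (sym (arityTs-leaves _)) p) ⟩
    ∣ Cor C x px ∣ + ∣ Cor C y py ∣
      ≡⟨ cong₂ _+_ (arityTs-leaves (arity x)) (arityTs-leaves (arity y)) ⟩
    arity x + arity y
      ≡⟨ m+[n∸m]≡n (≤-trans (arity-pos x) (m≤m+n _ _)) ⟨
    suc (arity x + arity y ∸ 1)
      ≡⟨ cong suc (comp-arity x i p y q) ⟨
    suc (arity (comp x i p y q))
      ≡⟨ cong suc (arityTs-leaves _) ⟨
    suc ∣ Cor C (comp x i p y q) pxy ∣ ∎)
    where open ≡-Reasoning
  arity-resp ≈-refl        = refl
  arity-resp (≈-sym e)     = sym (arity-resp e)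
  arity-resp (≈-trans d e) = trans (arity-resp d) (arity-resp e)
  arity-resp (≈-graft {S} {S′} {T} {T′} i r d e) = suc-injective (begin
    suc ∣ graft C S i T ∣    ≡⟨ arity-graft S T r ⟩
    ∣ S ∣ + ∣ T ∣            ≡⟨ cong₂ _+_ (arity-resp d) (arity-resp e) ⟩
    ∣ S′ ∣ + ∣ T′ ∣          ≡⟨ arity-graft S′ T′ (subst (i <_) (arity-resp d) r) ⟨
    suc ∣ graft C S′ i T′ ∣  ∎)
    where open ≡-Reasoning

  mutual
    arity-positive : ∀ S → 1 ≤ ∣ S ∣
    arity-positive leaf          = ≤-refl
    arity-positive (node x p ts) =
      ≤-trans (arity-pos x) (length≤arityTs ts)

    length≤arityTs : ∀ {n} (ts : Vec 𝕋 n) → n ≤ arityTs C ts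
    length≤arityTs []       = z≤n
    length≤arityTs (t ∷ ts) = +-mono-≤ (arity-positive t) (length≤arityTs ts)

  -- Labels have at least two children and every child has a leaf, so a tree with a node has arity
  -- at least two. This forces the value of a morphism at `leaf`.
  arity-one : ∀ S → ∣ S ∣ ≡ 1 → S ≡ leaf
  arity-one leaf          _ = refl
  arity-one (node x p ts) e = contradiction
    (≤-trans (recompute (2 ≤? arity x) p) (subst (arity x ≤_) e (length≤arityTs ts))) λ { (s≤s ()) }

  -- Nodes with lists of children, built one graft at a time.

  -- The children of a node form a vector of length arity x.  Lists are easier to cut and
  -- concatenate, so a list of children is padded with leaves or truncated to that length.
  fit : ∀ n → List 𝕋 → Vec 𝕋 n
  fit zero    _        = []
  fit (suc n) []       = leaf ∷ fit n []
  fit (suc n) (t ∷ ts) = t ∷ fit n ts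

  nodeL : (x : Carrier) → .(2 ≤ arity x) → List 𝕋 → 𝕋
  nodeL x p ts = node x p (fit (arity x) ts)

  fit-toList : ∀ {n} (ts : Vec 𝕋 n) → fit n (toList ts) ≡ ts
  fit-toList []       = refl
  fit-toList (t ∷ ts) = cong (t ∷_) (fit-toList ts)

  toList-fit : ∀ {n} ts → length ts ≡ n → toList (fit n ts) ≡ ts
  toList-fit []       refl = refl
  toList-fit (t ∷ ts) refl = cong (t ∷_) (toList-fit ts refl)

  fit-leaves : ∀ n ts → All (_≡ leaf) ts → fit n ts ≡ Vec.replicate n leaf
  fit-leaves zero    _        _            = refl
  fit-leaves (suc n) []       _            = cong (leaf ∷_) (fit-leaves n [] [])
  fit-leaves (suc n) (t ∷ ts) (refl ∷ all) = cong (leaf ∷_) (fit-leaves n ts all)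

  leaves : ℕ → List 𝕋
  leaves n = replicate n leaf

  all-leaves : ∀ n → All (_≡ leaf) (leaves n)
  all-leaves zero    = []
  all-leaves (suc n) = refl ∷ all-leaves n

  nodeL-leaves : ∀ x .(p : 2 ≤ arity x) ts → All (_≡ leaf) ts → nodeL x p ts ≡ Cor C x p
  nodeL-leaves x p ts all = cong (node x p) (fit-leaves (arity x) ts all)

  arityL : List 𝕋 → ℕ
  arityL ts = sum (map (arityT C) ts)

  arityL-++ : ∀ ss ts → arityL (ss ++ ts) ≡ arityL ss + arityL ts
  arityL-++ ss ts = trans (cong sum (map-++ _ ss ts)) (sum-++ (map _ ss) _)

  arityL-leaves : ∀ n → arityL (leaves n) ≡ n
  arityL-leaves zero    = refl
  arityL-leaves (suc n) = cong suc (arityL-leaves n)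

  arity-fit : ∀ {n} ts → length ts ≡ n → arityTs C (fit n ts) ≡ arityL ts
  arity-fit []       refl = refl
  arity-fit (t ∷ ts) refl = cong (∣ t ∣ +_) (arity-fit ts refl)

  -- Leaves are numbered from left to right, so leaf `i` of `S` comes after all those of `as`;
  -- `length as < n` ensures that `fit` does not cut `S` off.
  graft-fit : ∀ n as {S bs i} T → length as < n → i < ∣ S ∣ →
              graftTs C (fit n (as ++ S ∷ bs)) (arityL as + i) T ≡ fit n (as ++ graft C S i T ∷ bs)
  graft-fit (suc n) []       T l       r = graftTs-here _ _ T r
  graft-fit (suc n) (a ∷ as) {S} {bs} {i} T (s≤s l) r
    rewrite +-assoc ∣ a ∣ (arityL as) i
    = trans (graftTs-there a (fit n (as ++ S ∷ bs)) (arityL as + i) T)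
            (cong (a ∷_) (graft-fit n as T l r))

  range-fit : ∀ n as {S bs i} → length as < n → i < ∣ S ∣ →
              arityL as + i < arityTs C (fit n (as ++ S ∷ bs))
  range-fit (suc n) []       l       r = ≤-trans r (m≤m+n _ _)
  range-fit (suc n) (a ∷ as) {S} {bs} {i} (s≤s l) r
    rewrite +-assoc ∣ a ∣ (arityL as) i
    = +-monoʳ-< ∣ a ∣ (range-fit n as l r)

  fill : (Q : 𝕋 → Set) (R : List 𝕋 → Set) →
         (∀ us t vs → Q t → R (us ++ leaf ∷ vs) → R (us ++ t ∷ vs)) →
         ∀ us ts → All Q ts → R (us ++ leaves (length ts)) → R (us ++ ts)
  fill Q R step us []       []       h = h
  fill Q R step us (t ∷ ts) (q ∷ qs) h =
    subst R (++-assoc us (t ∷ []) ts)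
      (fill Q R step (us ++ t ∷ []) ts qs
        (subst R (sym (++-assoc us (t ∷ []) _)) (step us t _ q h)))

  length-insert : ∀ (us : List 𝕋) {s} t {vs} → length (us ++ s ∷ vs) ≡ length (us ++ t ∷ vs)
  length-insert []       t = refl
  length-insert (u ∷ us) t = cong suc (length-insert us t)

  length-prefix : ∀ (us : List 𝕋) {t vs} → length us < length (us ++ t ∷ vs)
  length-prefix []       = s≤s z≤n
  length-prefix (u ∷ us) = s≤s (length-prefix us)

  graft-hole : ∀ x .(p : 2 ≤ arity x) us t {vs} → length us < arity x →
               graft C (nodeL x p (us ++ leaf ∷ vs)) (arityL us + 0) t ≡ nodeL x p (us ++ t ∷ vs)
  graft-hole x p us t l = cong (node x p) (graft-fit (arity x) us t l (s≤s z≤n))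

  -- A node is its corolla with the children grafted into its leaves one after another. This is why
  -- a morphism is determined by its values on corollas.
  tree-induction : (P : 𝕋 → Set) → P leaf → (∀ x (p : 2 ≤ arity x) → P (Cor C x p)) →
                   (∀ S i T → i < ∣ S ∣ → P S → P T → P (graft C S i T)) → ∀ S → P S
  tree-induction P P-leaf P-Cor P-graft = go
    where
    go  : ∀ S → P S
    gos : ∀ {n} (ts : Vec 𝕋 n) → All P (toList ts)
    go leaf = P-leaf
    go (node x p ts) = subst P (cong (node x p) (fit-toList ts))
      (fill P (λ us → length us ≡ arity x → P (nodeL x p us)) step [] (toList ts) (gos ts)
        (λ _ → subst P (sym (nodeL-leaves x p _ (all-leaves (length (toList ts)))))
                       (P-Cor x (recompute (2 ≤? arity x) p)))
        (length-toList ts))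
      where
      step : ∀ us t vs → P t → (length (us ++ leaf ∷ vs) ≡ arity x → P (nodeL x p (us ++ leaf ∷ vs))) →
             length (us ++ t ∷ vs) ≡ arity x → P (nodeL x p (us ++ t ∷ vs))
      step us t vs pt h l =
        subst P (graft-hole x p us t l′)
          (P-graft _ _ t (range-fit (arity x) us l′ (s≤s z≤n))
                   (h (trans (length-insert us t) l)) pt)
        where l′ = subst (length us <_) l (length-prefix us)
    gos []       = []
    gos (t ∷ ts) = go t ∷ gos ts

  hole-cong : ∀ {U U′ V V′ t t′} a → a < ∣ U ∣ → graft C U a t ≡ U′ → graft C V a t′ ≡ V′ →
              U ≈ V → t ≈ t′ → U′ ≈ V′
  hole-cong a r refl refl e e′ = ≈-graft a r e e′

  -- The relation is closed under grafting by definition; congruence in the children is derived.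
  -- With the head turned into a leaf of the prefix, the tails are exchanged by induction, and then
  -- the two heads are grafted into that leaf.
  nodeL-cong : ∀ x .(p : 2 ≤ arity x) us {ts ts′} → length us + length ts ≤ arity x →
               Pointwise _≈_ ts ts′ → nodeL x p (us ++ ts) ≈ nodeL x p (us ++ ts′)
  nodeL-cong x p us l [] = ≈-refl
  nodeL-cong x p us {t ∷ ts} {t′ ∷ ts′} l (e ∷ es) =
    hole-cong (arityL us + 0) (range-fit (arity x) us l′ (s≤s z≤n))
      (graft-hole x p us t l′) (graft-hole x p us t′ l′)
      (subst₂ (λ as bs → nodeL x p as ≈ nodeL x p bs)
        (++-assoc us (leaf ∷ []) ts) (++-assoc us (leaf ∷ []) ts′)
        (nodeL-cong x p (us ++ leaf ∷ [])
          (subst (_≤ arity x)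
            (trans (+-suc (length us) (length ts))
              (cong (_+ length ts) (trans (+-comm 1 (length us)) (sym (length-++ us))))) l) es))
      e
    where l′ = ≤-trans (s≤s (m≤m+n (length us) (length ts))) (subst (_≤ arity x) (+-suc _ _) l)

  -- Contraction of an edge with matching colours.

  Matches : Carrier → ℕ → Carrier → Set
  Matches x i y = Σ (i < arity x) λ p → out y ≡ inp x i p

  compM : ∀ x i y → Matches x i y → Carrier
  compM x i y (p , q) = comp x i p y q

  -- `r` counts the inputs of `x` after `i`, which replaces the subtraction in `comp-arity`.
  arity-compM : ∀ {x i y} (m : Matches x i y) {r} → i + suc r ≡ arity x →
                arity (compM x i y m) ≡ i + (arity y + r)
  arity-compM {x} {i} {y} (p , q) {r} e = begin
    arity (comp x i p y q)    ≡⟨ comp-arity x i p y q ⟩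
    arity x + arity y ∸ 1     ≡⟨ cong (λ n → n + arity y ∸ 1) (trans (sym e) (+-suc i r)) ⟩
    i + r + arity y           ≡⟨ +-assoc i r _ ⟩
    i + (r + arity y)         ≡⟨ cong (i +_) (+-comm r _) ⟩
    i + (arity y + r)         ∎
    where open ≡-Reasoning

  2≤compM : ∀ {x i y} (m : Matches x i y) → 2 ≤ arity x → 2 ≤ arity (compM x i y m)
  2≤compM {x} {i} {y} (p , q) 2≤x = subst (2 ≤_)
    (sym (trans (comp-arity x i p y q) (+-∸-assoc (arity x) (arity-pos y))))
    (≤-trans 2≤x (m≤m+n _ _))

  module Contraction {x i y} (px : 2 ≤ arity x) (py : 2 ≤ arity y) (m : Matches x i y) where
    private
      xy  = compM x i y m
      pxy : 2 ≤ arity xy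
      pxy = 2≤compM m px

    -- `as` and `bs` are the siblings to the left and right of the node `y`, and `us` its children.
    Contracts : List 𝕋 → List 𝕋 → List 𝕋 → Set
    Contracts as us bs =
      length as ≡ i → length us ≡ arity y → i + suc (length bs) ≡ arity x →
      nodeL x px (as ++ nodeL y py us ∷ bs) ≈ nodeL xy pxy (as ++ us ++ bs)

    -- This is `≈-base` in list notation, the case from which the general one is obtained by filling
    -- leaves.
    corollas : ∀ n → Contracts (leaves i) (leaves (arity y)) (leaves n)
    corollas n _ _ e = subst₂ _≈_ l r (≈-base x px y py i (proj₁ m) (proj₂ m) pxy)
      where
      i<x : length (leaves i) < arity x
      i<x = subst (_< arity x) (sym (length-replicate i)) (proj₁ m)
      l : graft C (Cor C x px) i (Cor C y py) ≡
          nodeL x px (leaves i ++ nodeL y py (leaves (arity y)) ∷ leaves n)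
      l = begin
        graft C (Cor C x px) i (Cor C y py)
          ≡⟨ cong₂ (λ S j → graft C S j (Cor C y py))
               (nodeL-leaves x px (leaves i ++ leaf ∷ leaves n)
                 (++⁺ (all-leaves i) (refl ∷ all-leaves n)))
               (trans (+-identityʳ _) (arityL-leaves i)) ⟨
        graft C (nodeL x px (leaves i ++ leaf ∷ leaves n)) (arityL (leaves i) + 0) (Cor C y py)
          ≡⟨ graft-hole x px (leaves i) (Cor C y py) i<x ⟩
        nodeL x px (leaves i ++ Cor C y py ∷ leaves n)
          ≡⟨ cong (λ S → nodeL x px (leaves i ++ S ∷ leaves n))
                  (nodeL-leaves y py _ (all-leaves (arity y))) ⟨
        nodeL x px (leaves i ++ nodeL y py (leaves (arity y)) ∷ leaves n) ∎
        where open ≡-Reasoning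
      r : Cor C xy pxy ≡ nodeL xy pxy (leaves i ++ leaves (arity y) ++ leaves n)
      r = sym (nodeL-leaves xy pxy _ (++⁺ (all-leaves i) (++⁺ (all-leaves (arity y)) (all-leaves n))))

    length-xy : ∀ (as us bs : List 𝕋) → length as ≡ i → length us ≡ arity y → i + suc (length bs) ≡ arity x →
                length (as ++ us ++ bs) ≡ arity xy
    length-xy as us bs la lu lb = begin
      length (as ++ us ++ bs)              ≡⟨ length-++ as ⟩
      length as + length (us ++ bs)        ≡⟨ cong₂ _+_ la (length-++ us) ⟩
      i + (length us + length bs)          ≡⟨ cong (λ n → i + (n + length bs)) lu ⟩
      i + (arity y + length bs)            ≡⟨ arity-compM m lb ⟨
      arity xy                             ∎
      where open ≡-Reasoning

    length-x : ∀ (as : List 𝕋) {t} bs → length as ≡ i → i + suc (length bs) ≡ arity x →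
               length (as ++ t ∷ bs) ≡ arity x
    length-x as bs la lb = trans (length-++ as) (trans (cong (_+ suc (length bs)) la) lb)

    -- Contracting an edge moves no leaf, so the hole has the same index on both sides (`pos`) and
    -- one use of `≈-graft` fills both. The other two kinds of hole are treated alike.
    hole-after : ∀ as us bs t bs′ → Contracts as us (bs ++ leaf ∷ bs′) → Contracts as us (bs ++ t ∷ bs′)
    hole-after as us bs t bs′ h la lu lb =
      subst₂ _≈_ (cong (nodeL x px) (++-assoc as _ _)) (cong (nodeL xy pxy) (sym (reassoc t)))
        (hole-cong (arityL (as ++ nodeL y py us ∷ bs) + 0)
          (range-fit (arity x) (as ++ nodeL y py us ∷ bs) l (s≤s z≤n))
          (graft-hole x px (as ++ nodeL y py us ∷ bs) t l)
          (trans (cong (λ n → graft C (nodeL xy pxy ((as ++ us ++ bs) ++ leaf ∷ bs′)) (n + 0) t) pos)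
                 (graft-hole xy pxy (as ++ us ++ bs) t l′))
          (subst₂ _≈_
            (cong (nodeL x px) (sym (++-assoc as _ _)))
            (cong (nodeL xy pxy) (reassoc leaf))
            (h la lu lb′)) ≈-refl)
      where
      reassoc : ∀ s → as ++ us ++ bs ++ s ∷ bs′ ≡ (as ++ us ++ bs) ++ s ∷ bs′
      reassoc s = sym (trans (++-assoc as _ _) (cong (as ++_) (++-assoc us bs _)))
      lb′ : i + suc (length (bs ++ leaf ∷ bs′)) ≡ arity x
      lb′ = trans (cong (λ n → i + suc n) (length-insert bs t)) lb
      l : length (as ++ nodeL y py us ∷ bs) < arity x
      l = subst (length (as ++ nodeL y py us ∷ bs) <_)
            (trans (cong length (++-assoc as (nodeL y py us ∷ bs) (t ∷ bs′)))
                   (length-x as {nodeL y py us} (bs ++ t ∷ bs′) la lb))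
            (length-prefix (as ++ nodeL y py us ∷ bs))
      l′ : length (as ++ us ++ bs) < arity xy
      l′ = subst (length (as ++ us ++ bs) <_)
             (trans (cong length (sym (reassoc t))) (length-xy as us (bs ++ t ∷ bs′) la lu lb))
             (length-prefix (as ++ us ++ bs))
      pos : arityL (as ++ nodeL y py us ∷ bs) ≡ arityL (as ++ us ++ bs)
      pos = begin
        arityL (as ++ nodeL y py us ∷ bs)               ≡⟨ arityL-++ as _ ⟩
        arityL as + (∣ nodeL y py us ∣ + arityL bs)     ≡⟨ cong (λ n → arityL as + (n + arityL bs)) (arity-fit us lu) ⟩
        arityL as + (arityL us + arityL bs)             ≡⟨ cong (arityL as +_) (arityL-++ us bs) ⟨
        arityL as + arityL (us ++ bs)                   ≡⟨ arityL-++ as _ ⟨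
        arityL (as ++ us ++ bs)                         ∎
        where open ≡-Reasoning

    hole-inside : ∀ as bs us t us′ → Contracts as (us ++ leaf ∷ us′) bs → Contracts as (us ++ t ∷ us′) bs
    hole-inside as bs us t us′ h la lu lb =
      subst (nodeL x px (as ++ nodeL y py (us ++ t ∷ us′) ∷ bs) ≈_) (cong (nodeL xy pxy) (sym (reassoc t)))
        (hole-cong (arityL as + (arityL us + 0))
          (range-fit (arity x) as la′ inner)
          (trans (cong (node x px) (graft-fit (arity x) as t la′ inner))
                 (cong (λ S → nodeL x px (as ++ S ∷ bs)) (graft-hole y py us t lu′)))
          (trans (cong (λ n → graft C (nodeL xy pxy ((as ++ us) ++ leaf ∷ us′ ++ bs)) n t) pos)
                 (graft-hole xy pxy (as ++ us) t l′))
          (subst (nodeL x px (as ++ nodeL y py (us ++ leaf ∷ us′) ∷ bs) ≈_) (cong (nodeL xy pxy) (reassoc leaf))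
            (h la (trans (length-insert us t) lu) lb)) ≈-refl)
      where
      reassoc : ∀ s → as ++ (us ++ s ∷ us′) ++ bs ≡ (as ++ us) ++ s ∷ us′ ++ bs
      reassoc s = trans (cong (as ++_) (++-assoc us _ _)) (sym (++-assoc as us _))
      la′ : length as < arity x
      la′ = subst (_< arity x) (sym la) (proj₁ m)
      lu′ : length us < arity y
      lu′ = subst (length us <_) lu (length-prefix us)
      inner : arityL us + 0 < ∣ nodeL y py (us ++ leaf ∷ us′) ∣
      inner = range-fit (arity y) us lu′ (s≤s z≤n)
      l′ : length (as ++ us) < arity xy
      l′ = subst (length (as ++ us) <_)
             (trans (cong length (sym (reassoc t))) (length-xy as (us ++ t ∷ us′) bs la lu lb))
             (length-prefix (as ++ us))
      pos : arityL as + (arityL us + 0) ≡ arityL (as ++ us) + 0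
      pos = trans (sym (+-assoc (arityL as) _ _)) (cong (_+ 0) (sym (arityL-++ as us)))

    hole-before : ∀ us bs as t as′ → Contracts (as ++ leaf ∷ as′) us bs → Contracts (as ++ t ∷ as′) us bs
    hole-before us bs as t as′ h la lu lb =
      subst₂ _≈_ (cong (nodeL x px) (sym (++-assoc as _ _))) (cong (nodeL xy pxy) (sym (++-assoc as _ _)))
        (hole-cong (arityL as + 0)
          (range-fit (arity x) as l (s≤s z≤n))
          (graft-hole x px as t l)
          (graft-hole xy pxy as t l′)
          (subst₂ _≈_ (cong (nodeL x px) (++-assoc as _ _)) (cong (nodeL xy pxy) (++-assoc as _ _))
            (h (trans (length-insert as t) la) lu lb)) ≈-refl)
      where
      l : length as < arity x
      l = subst (length as <_)
            (trans (cong length (sym (++-assoc as (t ∷ as′) _))) (length-x (as ++ t ∷ as′) {nodeL y py us} bs la lb))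
            (length-prefix as)
      l′ : length as < arity xy
      l′ = subst (length as <_)
             (trans (cong length (sym (++-assoc as (t ∷ as′) _))) (length-xy (as ++ t ∷ as′) us bs la lu lb))
             (length-prefix as)

    -- From corollas, the leaves are filled in three rounds: right siblings, children of `y`, left
    -- siblings.
    contract : ∀ as us bs → Contracts as us bs
    contract as us bs la lu lb =
      fill ⊤′ (λ as → Contracts as us bs) (λ as t as′ _ → hole-before us bs as t as′) [] as (all⊤ as)
        (subst (λ n → Contracts (leaves n) us bs) (sym la)
          (fill ⊤′ (λ us → Contracts (leaves i) us bs) (λ us t us′ _ → hole-inside (leaves i) bs us t us′) [] us (all⊤ us)
            (subst (λ n → Contracts (leaves i) (leaves n) bs) (sym lu)
              (fill ⊤′ (Contracts (leaves i) (leaves (arity y)))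
                (λ bs t bs′ _ → hole-after (leaves i) (leaves (arity y)) bs t bs′) [] bs (all⊤ bs)
                (corollas (length bs))))))
        la lu lb
      where
      ⊤′ : 𝕋 → Set
      ⊤′ _ = ⊤
      all⊤ : ∀ ts → All ⊤′ ts
      all⊤ = universal (λ _ → tt)

-- Rose trees without arity constraints, and environments.

data Rose (X : Set) : Set where
  tip    : Rose X
  branch : X → List (Rose X) → Rose X

branch-injective : ∀ {X : Set} {x y : X} {us vs} → branch x us ≡ branch y vs → x ≡ y × us ≡ vs
branch-injective refl = refl , refl

-- The environment ρ with entry i replaced by the m entries ρ i, …, ρ (i + m - 1), collapsed to a.
collapse : ∀ {A : Set} → (ℕ → A) → ℕ → ℕ → A → ℕ → A
collapse ρ zero    m a zero    = a
collapse ρ zero    m a (suc j) = ρ (m + j)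
collapse ρ (suc i) m a zero    = ρ 0
collapse ρ (suc i) m a (suc j) = collapse (ρ ∘ suc) i m a j

module _ {A : Set} where
  collapse-below : ∀ (ρ : ℕ → A) n i {m a j} → j < n → collapse ρ (n + i) m a j ≡ ρ j
  collapse-below ρ (suc n) i {j = zero}  _       = refl
  collapse-below ρ (suc n) i {j = suc j} (s≤s r) = collapse-below (ρ ∘ suc) n i r

  -- `n`, `m` and `g` are the arities of the tree grafted into, of the grafted tree and of the
  -- result, related as in `arity-graft`.
  collapse-above : ∀ (ρ : ℕ → A) i {n m g a} j → i < n → suc g ≡ n + m →
                   collapse ρ i m a (n + j) ≡ ρ (g + j)
  collapse-above ρ zero    {suc n} {m} j _ refl =
    cong ρ (trans (sym (+-assoc m n j)) (cong (_+ j) (+-comm m n)))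
  collapse-above ρ (suc i) {suc (suc n)} j (s≤s r) refl = collapse-above (ρ ∘ suc) i j r refl

  collapse-shift : ∀ (ρ : ℕ → A) n i {m a} j →
                   collapse ρ (n + i) m a (n + j) ≡ collapse (ρ ∘ (n +_)) i m a j
  collapse-shift ρ zero    i j = refl
  collapse-shift ρ (suc n) i j = collapse-shift (ρ ∘ suc) n i j

  collapse-cong : ∀ (ρ : ℕ → A) i {m a a′} j → a ≡ a′ → collapse ρ i m a j ≡ collapse ρ i m a′ j
  collapse-cong ρ i j refl = refl

  applyUpTo-+ : ∀ (ρ : ℕ → A) i n → applyUpTo ρ (i + n) ≡ applyUpTo ρ i ++ applyUpTo (ρ ∘ (i +_)) n
  applyUpTo-+ ρ zero    n = refl
  applyUpTo-+ ρ (suc i) n = cong (ρ 0 ∷_) (applyUpTo-+ (ρ ∘ suc) i n)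

  applyUpTo-collapse : ∀ (ρ : ℕ → A) i r {m a} → applyUpTo (collapse ρ i m a) (i + suc r) ≡
                       applyUpTo ρ i ++ a ∷ applyUpTo (λ j → ρ (i + (m + j))) r
  applyUpTo-collapse ρ zero    r = refl
  applyUpTo-collapse ρ (suc i) r = cong (ρ 0 ∷_) (applyUpTo-collapse (ρ ∘ suc) i r)

-- Absorption of matching children.

module NormalForms {k : ℕ} (C : ColouredOperad k) where
  open ColouredOperad C
  open Trees C

  -- Hence `compM` depends only on `x`, `i` and `y`, whichever proof of definedness is supplied.
  Matches-irrelevant : ∀ {x i y} (m m′ : Matches x i y) → m ≡ m′
  Matches-irrelevant (p , q) (p′ , q′) with ≤-irrelevant p p′
  ... | refl = cong (p ,_) (uip q q′)

  matches? : ∀ x i y → Dec (Matches x i y)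
  matches? x i y with i <? arity x
  ... | no i≮x = no (i≮x ∘ proj₁)
  ... | yes p with out y Fin.≟ inp x i p
  ...   | yes q = yes (p , q)
  ...   | no ¬q = no λ (p′ , q′) → ¬q (trans q′ (cong (inp x i) (≤-irrelevant p′ p)))

  𝕊 : Set
  𝕊 = Carrier × List (Rose Carrier)

  -- The second component takes the place of child `i`: it is that child itself, or the children
  -- left behind when its root is contracted into `x`.
  plug : Carrier → ℕ → Rose Carrier → 𝕊
  plug x i tip = x , tip ∷ []
  plug x i (branch y us) with matches? x i y
  ... | yes m = compM x i y m , us
  ... | no _  = x , branch y us ∷ []

  plug-yes : ∀ {x i y us} (m : Matches x i y) → plug x i (branch y us) ≡ (compM x i y m , us)
  plug-yes {x} {i} {y} m with matches? x i y
  ... | yes m′ = cong (λ m → compM x i y m , _) (Matches-irrelevant m′ m)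
  ... | no ¬m  = contradiction m ¬m

  plug-no : ∀ {x i y us} → ¬ Matches x i y → plug x i (branch y us) ≡ (x , branch y us ∷ [])
  plug-no {x} {i} {y} ¬m with matches? x i y
  ... | yes m = contradiction m ¬m
  ... | no _  = refl

  -- Absorption runs from the last child to the first, so that the positions of the
  -- children still to be treated do not move.
  step : ℕ → Rose Carrier → 𝕊 → 𝕊
  step o t (x , us) = proj₁ (plug x o t) , proj₂ (plug x o t) ++ us

  absorb : ℕ → List (Rose Carrier) → 𝕊 → 𝕊
  absorb o []       s = s
  absorb o (t ∷ ts) s = step o t (absorb (suc o) ts s)

  toRose : 𝕊 → Rose Carrier
  toRose (x , us) = branch x us

  -- This is the action of a node on values. One sweep over the root edges suffices when the
  -- children are normal: a grandchild that moves up faces the same input colour as before.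
  construct : Carrier → List (Rose Carrier) → Rose Carrier
  construct x ts = toRose (absorb 0 ts (x , []))

  absorb-++ : ∀ o ss ts s → absorb o (ss ++ ts) s ≡ absorb o ss (absorb (o + length ss) ts s)
  absorb-++ o []       ts s = cong (λ n → absorb n ts s) (sym (+-identityʳ o))
  absorb-++ o (t ∷ ss) ts s = cong (step o t) (trans (absorb-++ (suc o) ss ts s)
    (cong (λ n → absorb (suc o) ss (absorb n ts s)) (sym (+-suc o (length ss)))))

  arity-comp≥ : ∀ {x i y} (m : Matches x i y) → arity x ≤ arity (compM x i y m)
  arity-comp≥ {x} {i} {y} (p , q) = subst (arity x ≤_)
    (sym (trans (comp-arity x i p y q) (+-∸-assoc (arity x) (arity-pos y)))) (m≤m+n _ _)

  arity-plug≥ : ∀ x o t → arity x ≤ arity (proj₁ (plug x o t))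
  arity-plug≥ x o tip = ≤-refl
  arity-plug≥ x o (branch y us) with matches? x o y
  ... | yes m = arity-comp≥ m
  ... | no _  = ≤-refl

  arity-absorb≥ : ∀ o ts s → arity (proj₁ s) ≤ arity (proj₁ (absorb o ts s))
  arity-absorb≥ o []       s = ≤-refl
  arity-absorb≥ o (t ∷ ts) s = ≤-trans (arity-absorb≥ (suc o) ts s) (arity-plug≥ _ o t)

  out-plug : ∀ x o t → out (proj₁ (plug x o t)) ≡ out x
  out-plug x o tip = refl
  out-plug x o (branch y us) with matches? x o y
  ... | yes (p , q) = comp-out x o p y q
  ... | no _        = refl

  out-absorb : ∀ o ts s → out (proj₁ (absorb o ts s)) ≡ out (proj₁ s)
  out-absorb o []       s = refl
  out-absorb o (t ∷ ts) s = trans (out-plug _ o t) (out-absorb (suc o) ts s)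

  -- Absorption at a later input affects neither the existence nor the colour of input `i`, so a
  -- match is still available when the sweep reaches it.
  Matches-plug : ∀ {x i y} o t → i < o → Matches x i y → Matches (proj₁ (plug x o t)) i y
  Matches-plug o tip r m = m
  Matches-plug {x} {i} {y} o (branch w us) r (p , q) with matches? x o w
  ... | yes (p′ , q′) = p″ , trans q (sym (comp-inp-before x o p′ w q′ i p″ p r))
    where p″ = ≤-trans p (arity-comp≥ (p′ , q′))
  ... | no _ = p , q

  Matches-absorb : ∀ {i y} o ts s → i < o → Matches (proj₁ s) i y →
                   Matches (proj₁ (absorb o ts s)) i y
  Matches-absorb o []       s r m = m
  Matches-absorb o (t ∷ ts) s r m =
    Matches-plug o t r (Matches-absorb (suc o) ts s (m≤n⇒m≤1+n r) m)

  Matches-out : ∀ {x i y y′} → out y′ ≡ out y → Matches x i y → Matches x i y′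
  Matches-out e (p , q) = p , trans e q

  -- Input `o` of `x` becomes input `o + arity y ∸ 1` of the composite, with the same colour, so
  -- both sides take the same decision; if it is positive, `assoc-par` identifies the results.
  plug-par : ∀ {x i y} o t → i < o → (m : Matches x i y) (m′ : Matches (proj₁ (plug x o t)) i y) →
             plug (compM x i y m) (o + arity y ∸ 1) t ≡ (compM _ i y m′ , proj₂ (plug x o t))
  plug-par o tip r m m′ = cong (λ m → compM _ _ _ m , _) (Matches-irrelevant m m′)
  plug-par {x} {i} {y} o (branch w us) r m@(p , q) m′ with matches? x o w
  ... | yes (p₁ , q₁) = trans (plug-yes (p₂ , q₂))
          (cong (_, us) (assoc-par x i p y q o p₂ w q₂ p₁ q₁ (proj₁ m′) (proj₂ m′) r))
    where
    p₂ : o + arity y ∸ 1 < arity (comp x i p y q)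
    p₂ = subst (o + arity y ∸ 1 <_) (sym (comp-arity x i p y q))
           (∸-monoˡ-< (+-monoˡ-< (arity y) p₁) (≤-trans (arity-pos y) (m≤n+m _ o)))
    q₂ : out w ≡ inp (comp x i p y q) (o + arity y ∸ 1) p₂
    q₂ = trans q₁ (sym (comp-inp-after x i p y q o p₂ p₁ r))
  ... | no ¬m = trans (plug-no ¬m₂) (cong (λ m → compM x i y m , _) (Matches-irrelevant m m′))
    where
    ¬m₂ : ¬ Matches (comp x i p y q) (o + arity y ∸ 1) w
    ¬m₂ (p₂ , q₂) = ¬m (p₁ , trans q₂ (comp-inp-after x i p y q o p₂ p₁ r))
      where
      p₁ : o < arity x
      -- An index at or beyond `arity x` would be shifted to one at or beyond the arity of the
      -- composite.
      p₁ = ≰⇒> λ x≤o → <⇒≱ (subst (o + arity y ∸ 1 <_) (comp-arity x i p y q) p₂)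
                             (∸-monoˡ-≤ 1 (+-monoˡ-≤ (arity y) x≤o))

  -- The analogue, by `assoc-seq`, for an input `j` of `y`, which becomes input `i + j` of the
  -- composite; `j < arity y` keeps it among the inputs inherited from `y`.
  plug-seq : ∀ {x i y} j t → j < arity y → (m : Matches x i y) (m′ : Matches x i (proj₁ (plug y j t))) →
             plug (compM x i y m) (i + j) t ≡ (compM x i _ m′ , proj₂ (plug y j t))
  plug-seq j tip r m m′ = cong (λ m → compM _ _ _ m , _) (Matches-irrelevant m m′)
  plug-seq {x} {i} {y} j (branch w us) r m@(p , q) m′ with matches? y j w
  ... | yes (p₁ , q₁) = trans (plug-yes (p₂ , q₂))
          (cong (_, us) (assoc-seq x i p y q j p₂ w q₂ (proj₁ m′) p₁ q₁ (proj₂ m′)))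
    where
    p₂ : i + j < arity (comp x i p y q)
    p₂ = subst (i + j <_) (sym (comp-arity x i p y q)) 
           (subst (_≤ arity x + arity y ∸ 1) (+-suc i j) (∸-monoˡ-≤ 1 (+-mono-≤ p r)))
    q₂ : out w ≡ inp (comp x i p y q) (i + j) p₂
    q₂ = trans q₁ (sym (comp-inp-middle x i p y q j p₂ p₁))
  ... | no ¬m = trans (plug-no ¬m₂) (cong (λ m → compM x i y m , _) (Matches-irrelevant m m′))
    where
    ¬m₂ : ¬ Matches (comp x i p y q) (i + j) w
    ¬m₂ (p₂ , q₂) = ¬m (r , trans q₂ (comp-inp-middle x i p y q j p₂ r))

  absorb-par : ∀ {x i y} o ts us → i < o → (m : Matches x i y) →
               (m′ : Matches (proj₁ (absorb o ts (x , us))) i y) →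
               absorb (o + arity y ∸ 1) ts (compM x i y m , us) ≡
               (compM _ i y m′ , proj₂ (absorb o ts (x , us)))
  absorb-par o [] us r m m′ = cong (λ m → compM _ _ _ m , us) (Matches-irrelevant m m′)
  absorb-par {x} {i} {y} o (t ∷ ts) us r m m′ = begin
    step o⁺ t (absorb (suc o⁺) ts (compM x i y m , us))
      -- The position after `o⁺` is `o + arity y`, which is the shifted position of input `suc o`.
      ≡⟨ cong (λ n → step o⁺ t (absorb n ts (compM x i y m , us)))
              (m+[n∸m]≡n (≤-trans (arity-pos y) (m≤n+m _ o))) ⟩
    step o⁺ t (absorb (o + arity y) ts (compM x i y m , us))
      ≡⟨ cong (step o⁺ t) (absorb-par (suc o) ts us (m≤n⇒m≤1+n r) m m₁) ⟩
    step o⁺ t (compM _ i y m₁ , proj₂ s)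
      ≡⟨ cong (λ (z , vs) → z , vs ++ proj₂ s) (plug-par o t r m₁ m′) ⟩
    compM _ i y m′ , proj₂ (step o t s) ∎
    where
    open ≡-Reasoning
    o⁺ = o + arity y ∸ 1
    s  = absorb (suc o) ts (x , us)
    m₁ : Matches (proj₁ s) i y
    m₁ = Matches-absorb (suc o) ts (x , us) (m≤n⇒m≤1+n r) m

  absorb-seq : ∀ {x i y} j ts us → j + length ts ≤ arity y → (m : Matches x i y) →
               (m′ : Matches x i (proj₁ (absorb j ts (y , [])))) →
               absorb (i + j) ts (compM x i y m , us) ≡
               (compM x i _ m′ , proj₂ (absorb j ts (y , [])) ++ us)
  absorb-seq j [] us r m m′ = cong (λ m → compM _ _ _ m , us) (Matches-irrelevant m m′)
  absorb-seq {x} {i} {y} j (t ∷ ts) us r m m′ = begin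
    step (i + j) t (absorb (suc (i + j)) ts (compM x i y m , us))
      ≡⟨ cong (λ n → step (i + j) t (absorb n ts (compM x i y m , us))) (sym (+-suc i j)) ⟩
    step (i + j) t (absorb (i + suc j) ts (compM x i y m , us))
      ≡⟨ cong (step (i + j) t) (absorb-seq (suc j) ts us r′ m m₁) ⟩
    step (i + j) t (compM x i _ m₁ , proj₂ s ++ us)
      ≡⟨ cong (λ (z , vs) → z , vs ++ proj₂ s ++ us) (plug-seq j t j<s m₁ m′) ⟩
    compM x i _ m′ , proj₂ (plug (proj₁ s) j t) ++ proj₂ s ++ us
      ≡⟨ cong (compM x i _ m′ ,_) (sym (++-assoc (proj₂ (plug (proj₁ s) j t)) _ _)) ⟩
    compM x i _ m′ , proj₂ (step j t s) ++ us ∎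
    where
    open ≡-Reasoning
    s  = absorb (suc j) ts (y , [])
    m₁ : Matches x i (proj₁ s)
    m₁ = Matches-out (out-absorb (suc j) ts (y , [])) m
    r′ : suc j + length ts ≤ arity y
    r′ = subst (_≤ arity y) (+-suc j (length ts)) r
    j<s : j < arity (proj₁ s)
    j<s = ≤-trans (≤-trans (s≤s (m≤m+n j _)) r′) (arity-absorb≥ (suc j) ts (y , []))

  -- The relations of the enveloping operad hold for values. The sweep meets `bs` first, past which
  -- the composition moves by `absorb-par`. The subtree built from `y` is then absorbed, since its
  -- root keeps the output colour of `y`, and `absorb-seq` exchanges this with absorbing `ss`. The
  -- sweep over `as` is common to both sides.
  construct-comp : ∀ {x i y} (m : Matches x i y) as ss bs → length as ≡ i → length ss ≡ arity y →
                   construct x (as ++ construct y ss ∷ bs) ≡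
                   construct (compM x i y m) (as ++ ss ++ bs)
  construct-comp {x} {i} {y} m as ss bs refl ls = cong toRose (begin
    absorb 0 (as ++ construct y ss ∷ bs) (x , [])
      ≡⟨ absorb-++ 0 as _ _ ⟩
    absorb 0 as (step i (construct y ss) s)
      ≡⟨ cong (λ (z , vs) → absorb 0 as (z , vs ++ proj₂ s)) (plug-yes m₂) ⟩
    absorb 0 as (compM _ i _ m₂ , proj₂ (absorb 0 ss (y , [])) ++ proj₂ s)
      ≡⟨ cong (absorb 0 as) (absorb-seq 0 ss (proj₂ s) (≤-reflexive ls) m₁ m₂) ⟨
    absorb 0 as (absorb (i + 0) ss (compM _ i y m₁ , proj₂ s))
      ≡⟨ cong (λ n → absorb 0 as (absorb n ss (compM _ i y m₁ , proj₂ s))) (+-identityʳ i) ⟩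
    absorb 0 as (absorb i ss (compM _ i y m₁ , proj₂ s))
      ≡⟨ cong (λ s → absorb 0 as (absorb i ss s)) (absorb-par (suc i) bs [] ≤-refl m m₁) ⟨
    absorb 0 as (absorb i ss (absorb (i + arity y) bs (compM x i y m , [])))
      ≡⟨ cong (λ n → absorb 0 as (absorb i ss (absorb (i + n) bs (compM x i y m , [])))) ls ⟨
    absorb 0 as (absorb i ss (absorb (i + length ss) bs (compM x i y m , [])))
      ≡⟨ cong (absorb 0 as) (absorb-++ i ss bs _) ⟨
    absorb 0 as (absorb i (ss ++ bs) (compM x i y m , []))
      ≡⟨ absorb-++ 0 as _ _ ⟨
    absorb 0 (as ++ ss ++ bs) (compM x i y m , []) ∎)
    where
    open ≡-Reasoning
    s = absorb (suc i) bs (x , [])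
    m₁ : Matches (proj₁ s) i y
    m₁ = Matches-absorb (suc i) bs (x , []) ≤-refl m
    m₂ : Matches (proj₁ s) i (proj₁ (absorb 0 ss (y , [])))
    m₂ = Matches-out (out-absorb 0 ss (y , [])) m₁

  -- Evaluation of trees and its invariance under congruence.

  mutual
    -- The environment `ρ` supplies values for the leaves, numbered from the left and renumbered for
    -- each child.
    eval : 𝕋 → (ℕ → Rose Carrier) → Rose Carrier
    eval leaf          ρ = ρ 0
    eval (node x _ ts) ρ = construct x (evals ts ρ)

    evals : ∀ {n} → Vec 𝕋 n → (ℕ → Rose Carrier) → List (Rose Carrier)
    evals []       ρ = []
    evals (t ∷ ts) ρ = eval t ρ ∷ evals ts (ρ ∘ (∣ t ∣ +_))

  mutual
    eval-cong : ∀ S {ρ ρ′} → (∀ j → j < ∣ S ∣ → ρ j ≡ ρ′ j) → eval S ρ ≡ eval S ρ′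
    eval-cong leaf          h = h 0 (s≤s z≤n)
    eval-cong (node x _ ts) h = cong (construct x) (evals-cong ts h)

    evals-cong : ∀ {n} (ts : Vec 𝕋 n) {ρ ρ′} → (∀ j → j < arityTs C ts → ρ j ≡ ρ′ j) →
                 evals ts ρ ≡ evals ts ρ′
    evals-cong []       h = refl
    evals-cong (t ∷ ts) h = cong₂ _∷_
      (eval-cong t λ j r → h j (≤-trans r (m≤m+n _ _)))
      (evals-cong ts λ j r → h (∣ t ∣ + j) (+-monoʳ-< ∣ t ∣ r))

  mutual
    -- This makes values an algebra over the free operad: the `∣ T ∣` leaves from position `i` on
    -- belong to `T`, whose value then stands at leaf `i` of `S`.
    eval-graft : ∀ S {i} T ρ → i < ∣ S ∣ →
                 eval (graft C S i T) ρ ≡ eval S (collapse ρ i ∣ T ∣ (eval T (ρ ∘ (i +_))))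
    eval-graft leaf {zero}  T ρ _ = refl
    eval-graft leaf {suc i} T ρ (s≤s ())
    eval-graft (node x _ ts) T ρ r = cong (construct x) (evals-graft ts T ρ r)

    evals-graft : ∀ {n} (ts : Vec 𝕋 n) {i} T ρ → i < arityTs C ts →
                  evals (graftTs C ts i T) ρ ≡ evals ts (collapse ρ i ∣ T ∣ (eval T (ρ ∘ (i +_))))
    evals-graft (t ∷ ts) {i} T ρ r with below-or-above ∣ t ∣ i
    ... | inj₁ i<t rewrite graftTs-here t ts T i<t = cong₂ _∷_
      (eval-graft t T ρ i<t)
      (evals-cong ts λ j _ → sym (collapse-above ρ i j i<t (arity-graft t T i<t)))
    ... | inj₂ (i′ , refl) rewrite graftTs-there t ts i′ T = cong₂ _∷_
      (eval-cong t λ j j<t → sym (collapse-below ρ ∣ t ∣ i′ j<t))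
      (trans (evals-graft ts T (ρ ∘ (∣ t ∣ +_)) (+-cancelˡ-< ∣ t ∣ _ _ r))
        (evals-cong ts λ j _ → trans
          (collapse-cong _ i′ j (eval-cong T λ l _ → cong ρ (sym (+-assoc ∣ t ∣ i′ l))))
          (sym (collapse-shift ρ ∣ t ∣ i′ j))))

  evals-leaves : ∀ n ρ → evals (Vec.replicate n leaf) ρ ≡ applyUpTo ρ n
  evals-leaves zero    ρ = refl
  evals-leaves (suc n) ρ = cong (ρ 0 ∷_) (evals-leaves n (ρ ∘ suc))

  eval-base : ∀ {x i y} (px : 2 ≤ arity x) (py : 2 ≤ arity y) (m : Matches x i y) ρ →
              eval (graft C (Cor C x px) i (Cor C y py)) ρ ≡
              construct (compM x i y m) (applyUpTo ρ (arity (compM x i y m)))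
  eval-base {x} {i} {y} px py m@(i<x , _) ρ with m≤n⇒∃[o]m+o≡n i<x
  -- `r` is the number of inputs of `x` after `i`.
  ... | r , e = begin
    eval (graft C (Cor C x px) i (Cor C y py)) ρ
      ≡⟨ eval-graft (Cor C x px) (Cor C y py) ρ (subst (i <_) (sym (arityTs-leaves _)) i<x) ⟩
    construct x (evals (Vec.replicate (arity x) leaf) _)
      ≡⟨ cong (construct x) (evals-leaves (arity x) _) ⟩
    construct x (applyUpTo (collapse ρ i ∣ Cor C y py ∣ a) (arity x))
      ≡⟨ cong₂ (λ n l → construct x (applyUpTo (collapse ρ i n a) l))
               (arityTs-leaves (arity y)) (sym e′) ⟩
    construct x (applyUpTo (collapse ρ i (arity y) a) (i + suc r))
      ≡⟨ cong (construct x) (applyUpTo-collapse ρ i r) ⟩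
    construct x (applyUpTo ρ i ++ a ∷ applyUpTo (λ j → ρ (i + (arity y + j))) r)
      ≡⟨ cong (λ ss → construct x (applyUpTo ρ i ++ construct y ss ∷ _)) (evals-leaves (arity y) _) ⟩
    construct x (applyUpTo ρ i ++ construct y (applyUpTo (ρ ∘ (i +_)) (arity y)) ∷ _)
      ≡⟨ construct-comp m (applyUpTo ρ i) (applyUpTo (ρ ∘ (i +_)) (arity y)) _
           (length-applyUpTo ρ i) (length-applyUpTo _ (arity y)) ⟩
    construct xy (applyUpTo ρ i ++ applyUpTo (ρ ∘ (i +_)) (arity y) ++ _)
      ≡⟨ cong (λ ss → construct xy (applyUpTo ρ i ++ ss)) (applyUpTo-+ (ρ ∘ (i +_)) (arity y) r) ⟨
    construct xy (applyUpTo ρ i ++ applyUpTo (ρ ∘ (i +_)) (arity y + r))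
      ≡⟨ cong (construct xy) (applyUpTo-+ ρ i (arity y + r)) ⟨
    construct xy (applyUpTo ρ (i + (arity y + r)))
      ≡⟨ cong (construct xy ∘ applyUpTo ρ) (arity-compM m e′) ⟨
    construct xy (applyUpTo ρ (arity xy)) ∎
    where
    open ≡-Reasoning
    xy = compM x i y m
    a  = eval (Cor C y py) (ρ ∘ (i +_))
    e′ : i + suc r ≡ arity x
    e′ = trans (+-suc i r) e

  -- All environments are needed at once: in the graft case `S` is evaluated in a collapsed
  -- environment and `T` in a shifted one.
  eval-resp : ∀ {S T} → S ≈ T → ∀ ρ → eval S ρ ≡ eval T ρ
  eval-resp (≈-base x px y py i p q pxy) ρ =
    trans (eval-base px py (p , q) ρ) (cong (construct (comp x i p y q)) (sym (evals-leaves (arity (comp x i p y q)) ρ)))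
  eval-resp ≈-refl        ρ = refl
  eval-resp (≈-sym e)     ρ = sym (eval-resp e ρ)
  eval-resp (≈-trans d e) ρ = trans (eval-resp d ρ) (eval-resp e ρ)
  eval-resp (≈-graft {S} {S′} {T} {T′} i r d e) ρ = begin
    eval (graft C S i T) ρ
      ≡⟨ eval-graft S T ρ r ⟩
    eval S (collapse ρ i ∣ T ∣ (eval T (ρ ∘ (i +_))))
      ≡⟨ cong₂ (λ n a → eval S (collapse ρ i n a)) (arity-resp e) (eval-resp e (ρ ∘ (i +_))) ⟩
    eval S (collapse ρ i ∣ T′ ∣ (eval T′ (ρ ∘ (i +_))))
      ≡⟨ eval-resp d _ ⟩
    eval S′ (collapse ρ i ∣ T′ ∣ (eval T′ (ρ ∘ (i +_))))
      ≡⟨ eval-graft S′ T′ ρ (subst (i <_) (arity-resp d) r) ⟨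
    eval (graft C S′ i T′) ρ ∎
    where open ≡-Reasoning

  -- Every tree is congruent to its normal form.

  mutual
    forget : 𝕋 → Rose Carrier
    forget leaf          = tip
    forget (node x _ ts) = branch x (forgets ts)

    forgets : ∀ {n} → Vec 𝕋 n → List (Rose Carrier)
    forgets []       = []
    forgets (t ∷ ts) = forget t ∷ forgets ts

  mutual
    -- The label fixes the number of children, and the bound on its arity is proof-irrelevant.
    forget-injective : ∀ S T → forget S ≡ forget T → S ≡ T
    forget-injective leaf leaf _ = refl
    forget-injective (node x _ ts) (node y _ us) e with branch-injective e
    ... | refl , e′ = cong (node x _) (forgets-injective ts us e′)

    forgets-injective : ∀ {n} (ts us : Vec 𝕋 n) → forgets ts ≡ forgets us → ts ≡ us
    forgets-injective []       []       _ = refl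
    forgets-injective (t ∷ ts) (u ∷ us) e =
      cong₂ _∷_ (forget-injective t u (∷-injectiveˡ e)) (forgets-injective ts us (∷-injectiveʳ e))

  forgets-toList : ∀ {n} (ts : Vec 𝕋 n) → forgets ts ≡ map forget (toList ts)
  forgets-toList []       = refl
  forgets-toList (t ∷ ts) = cong (forget t ∷_) (forgets-toList ts)

  forget-nodeL : ∀ x .(p : 2 ≤ arity x) ts → length ts ≡ arity x →
                 forget (nodeL x p ts) ≡ branch x (map forget ts)
  forget-nodeL x p ts l = cong (branch x)
    (trans (forgets-toList (fit (arity x) ts)) (cong (map forget) (toList-fit ts l)))

  -- A state whose children start at position o, as a tree with its first o children missing.
  record Realisation (o : ℕ) (T : List 𝕋 → 𝕋) (s : 𝕊) : Set where
    field
      label    : Carrier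
      2≤label  : 2 ≤ arity label
      children : List 𝕋
      forgetful : s ≡ (label , map forget children)
      full     : o + length children ≡ arity label
      equiv    : ∀ as → length as ≡ o → T as ≈ nodeL label 2≤label (as ++ children)

  -- When the colours match, the absorption is a contraction of trees, given by
  -- `Contraction.contract`; otherwise the tree stays as it is.
  realise-plug : ∀ x (px : 2 ≤ arity x) o t ts → suc o + length ts ≡ arity x →
                 Realisation o (λ as → nodeL x px (as ++ t ∷ ts))
                             (step o (forget t) (x , map forget ts))
  realise-plug x px o leaf ts l = record
    { label = x ; 2≤label = px ; children = leaf ∷ ts ; forgetful = refl
    ; full = trans (+-suc o _) l ; equiv = λ _ _ → ≈-refl }
  realise-plug x px o (node y py us) ts l with matches? x o y
  ... | no _ = record
    { label = x ; 2≤label = px ; children = node y py us ∷ ts ; forgetful = refl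
    ; full = trans (+-suc o _) l ; equiv = λ _ _ → ≈-refl }
  ... | yes m = record
    { label = compM x o y m ; 2≤label = 2≤compM m px ; children = toList us ++ ts
    ; forgetful = cong (compM x o y m ,_)
        (trans (cong (_++ map forget ts) (forgets-toList us)) (sym (map-++ forget (toList us) ts)))
    ; full = trans (cong (o +_) (trans (length-++ (toList us)) (cong (_+ length ts) (length-toList us))))
                   (sym (arity-compM m l′))
    ; equiv = λ as la → subst (λ vs → nodeL x px (as ++ node y py vs ∷ ts) ≈
                                  nodeL (compM x o y m) (2≤compM m px) (as ++ toList us ++ ts)) (fit-toList us)
        (Contraction.contract px (recompute (2 ≤? arity y) py) m as (toList us) ts
          la (length-toList us) l′) }
    where l′ = trans (+-suc o _) l

  realise-absorb : ∀ x (px : 2 ≤ arity x) o ts → o + length ts ≡ arity x →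
                   Realisation o (λ as → nodeL x px (as ++ ts)) (absorb o (map forget ts) (x , []))
  realise-absorb x px o [] l = record
    { label = x ; 2≤label = px ; children = [] ; forgetful = refl ; full = l
    ; equiv = λ _ _ → ≈-refl }
  realise-absorb x px o (t ∷ ts) l = record
    { label = R′.label ; 2≤label = R′.2≤label ; children = R′.children
    ; forgetful = trans (cong (step o (forget t)) R.forgetful) R′.forgetful
    ; full = R′.full
    ; equiv = λ as la → ≈-trans
        (subst₂ _≈_ (cong (nodeL x px) (++-assoc as _ _)) (cong (nodeL R.label R.2≤label) (++-assoc as _ _))
          -- While the later siblings are absorbed, `t` counts as one more untreated child in front
          -- of them.
          (R.equiv (as ++ t ∷ []) (trans (length-++ as) (trans (+-comm (length as) 1) (cong suc la)))))
        (R′.equiv as la) }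
    where
    module R  = Realisation (realise-absorb x px (suc o) ts (trans (sym (+-suc o _)) l))
    module R′ = Realisation (realise-plug R.label R.2≤label o t R.children R.full)

  mutual
    -- Children are normalised first; `realise-absorb` then carries out on trees what `construct`
    -- does on values.
    normalise : ∀ S → Σ 𝕋 λ S′ → S ≈ S′ × forget S′ ≡ eval S (λ _ → tip)
    normalise leaf = leaf , ≈-refl , refl
    normalise (node x p ts) with normalises ts
    ... | ts′ , es , eq = nodeL R.label R.2≤label R.children , S≈S′ ,
        trans (forget-nodeL R.label R.2≤label R.children R.full)
              (cong toRose (trans (sym R.forgetful) (cong (λ ts → absorb 0 ts (x , [])) eq)))
      where
      px = recompute (2 ≤? arity x) p
      l : length ts′ ≡ arity x
      l = trans (sym (Pointwise-length es)) (length-toList ts)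
      module R = Realisation (realise-absorb x px 0 ts′ l)
      S≈S′ : node x p ts ≈ nodeL R.label R.2≤label R.children
      S≈S′ = ≈-trans
        (subst (λ us → node x p us ≈ nodeL x p ts′) (fit-toList ts)
          (nodeL-cong x p [] (≤-reflexive (length-toList ts)) es))
        (R.equiv [] refl)

    normalises : ∀ {n} (ts : Vec 𝕋 n) →
                 Σ (List 𝕋) λ ts′ → Pointwise _≈_ (toList ts) ts′ × map forget ts′ ≡ evals ts (λ _ → tip)
    normalises [] = [] , [] , refl
    normalises (t ∷ ts) with normalise t | normalises ts
    ... | t′ , e , eq | ts′ , es , eqs = t′ ∷ ts′ , e ∷ es , cong₂ _∷_ eq eqs

  -- Trees with equal values have the same normal form, to which both are congruent. With
  -- `eval-resp`, values at trivial leaves thus classify congruence classes.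
  eval-reflects : ∀ S T → eval S (λ _ → tip) ≡ eval T (λ _ → tip) → S ≈ T
  eval-reflects S T e with normalise S | normalise T
  ... | S′ , S≈S′ , eqS | T′ , T≈T′ , eqT = ≈-trans S≈S′
    (≈-trans (≈-reflexive (forget-injective S′ T′ (trans eqS (trans e (sym eqT))))) (≈-sym T≈T′))

-- Relabelling of rose trees.

module _ {X Y : Set} (f : X → Y) where
  mutual
    mapR : Rose X → Rose Y
    mapR tip           = tip
    mapR (branch x us) = branch (f x) (mapRs us)

    mapRs : List (Rose X) → List (Rose Y)
    mapRs []       = []
    mapRs (u ∷ us) = mapR u ∷ mapRs us

  mapRs-++ : ∀ us vs → mapRs (us ++ vs) ≡ mapRs us ++ mapRs vs
  mapRs-++ []       vs = refl
  mapRs-++ (u ∷ us) vs = cong (mapR u ∷_) (mapRs-++ us vs)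

  module _ (f-inj : ∀ x y → f x ≡ f y → x ≡ y) where
    mutual
      mapR-injective : ∀ u v → mapR u ≡ mapR v → u ≡ v
      mapR-injective tip tip _ = refl
      mapR-injective (branch x us) (branch y vs) e =
        cong₂ branch (f-inj x y (proj₁ (branch-injective e)))
                     (mapRs-injective us vs (proj₂ (branch-injective e)))

      mapRs-injective : ∀ us vs → mapRs us ≡ mapRs vs → us ≡ vs
      mapRs-injective [] [] _ = refl
      mapRs-injective (u ∷ us) (v ∷ vs) e =
        cong₂ _∷_ (mapR-injective u v (∷-injectiveˡ e)) (mapRs-injective us vs (∷-injectiveʳ e))

-- The induced operad morphism, its uniqueness and surjectivity.

module Relabelling {k : ℕ} {C₁ C₂ : ColouredOperad k} (φ : Morphism C₁ C₂) where
  private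
    module A where
      open ColouredOperad C₁ public
      open Trees C₁ public
      open NormalForms C₁ public
    module B where
      open ColouredOperad C₂ public
      open Trees C₂ public
      open NormalForms C₂ public

  2≤fun : ∀ {x} → 2 ≤ A.arity x → 2 ≤ B.arity (fun φ x)
  2≤fun {x} = subst (2 ≤_) (sym (fun-arity φ x))

  mutual
    relabel : A.𝕋 → B.𝕋
    relabel leaf          = leaf
    relabel (node x p ts) = node (fun φ x) (2≤fun p) (relabels (sym (fun-arity φ x)) ts)

    -- The vector changes its length along an irrelevant equation during the recursion, so no
    -- transport between arities enters the later proofs.
    relabels : ∀ {m n} → .(m ≡ n) → Vec A.𝕋 m → Vec B.𝕋 n
    relabels {n = zero}  e []       = []
    relabels {n = suc n} e (t ∷ ts) = relabel t ∷ relabels (suc-injective e) ts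

  mutual
    arity-relabel : ∀ S → B.∣ relabel S ∣ ≡ A.∣ S ∣
    arity-relabel leaf          = refl
    arity-relabel (node x p ts) = arity-relabels (sym (fun-arity φ x)) ts

    arity-relabels : ∀ {m n} .(e : m ≡ n) (ts : Vec A.𝕋 m) → arityTs C₂ (relabels e ts) ≡ arityTs C₁ ts
    arity-relabels {n = zero}  e []       = refl
    arity-relabels {n = suc n} e (t ∷ ts) = cong₂ _+_ (arity-relabel t) (arity-relabels (suc-injective e) ts)

  mutual
    relabel-graft : ∀ S i T → relabel (graft C₁ S i T) ≡ graft C₂ (relabel S) i (relabel T)
    relabel-graft leaf zero    T = refl
    relabel-graft leaf (suc i) T = refl
    relabel-graft (node x p ts) i T = cong (node (fun φ x) _) (relabels-graft _ ts i T)

    relabels-graft : ∀ {m n} .(e : m ≡ n) (ts : Vec A.𝕋 m) i T →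
                     relabels e (graftTs C₁ ts i T) ≡ graftTs C₂ (relabels e ts) i (relabel T)
    relabels-graft {n = zero}  e []       i T = refl
    relabels-graft {n = suc n} e (t ∷ ts) i T rewrite arity-relabel t with i <ᵇ A.∣ t ∣
    ... | true  = cong (_∷ _) (relabel-graft t i T)
    ... | false = cong (_ ∷_) (relabels-graft _ ts _ T)

  relabels-leaves : ∀ {m n} .(e : m ≡ n) → relabels e (Vec.replicate m leaf) ≡ Vec.replicate n leaf
  relabels-leaves {zero}  {zero}  e = refl
  relabels-leaves {suc m} {suc n} e = cong (leaf ∷_) (relabels-leaves _)

  relabel-Cor : ∀ x .(p : 2 ≤ A.arity x) → relabel (Cor C₁ x p) ≡ Cor C₂ (fun φ x) (2≤fun p)
  relabel-Cor x p = cong (node (fun φ x) _) (relabels-leaves _)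

  fun-Matches : ∀ {x i y} → A.Matches x i y → B.Matches (fun φ x) i (fun φ y)
  fun-Matches {x} {i} {y} (p , q) = p′ , proj₁ (fun-comp φ x i p y q p′)
    where p′ = subst (i <_) (sym (fun-arity φ x)) p

  fun-compM : ∀ {x i y} (m : A.Matches x i y) →
              fun φ (A.compM x i y m) ≡ B.compM _ i _ (fun-Matches m)
  fun-compM {x} {i} {y} (p , q) = proj₂ (fun-comp φ x i p y q _)

  Cor-cong : ∀ {x y} .(px : 2 ≤ B.arity x) .(py : 2 ≤ B.arity y) → x ≡ y → Cor C₂ x px ≡ Cor C₂ y py
  Cor-cong px py refl = refl

  relabel-resp : ∀ {S T} → S A.≈ T → relabel S B.≈ relabel T
  relabel-resp (≈-base x px y py i p q pxy) = subst₂ B._≈_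
    (trans (cong₂ (λ S T → graft C₂ S i T) (sym (relabel-Cor x px)) (sym (relabel-Cor y py)))
           (sym (relabel-graft (Cor C₁ x px) i (Cor C₁ y py))))
    (trans (Cor-cong _ _ (sym (fun-compM (p , q)))) (sym (relabel-Cor _ pxy)))
    (≈-base (fun φ x) (2≤fun px) (fun φ y) (2≤fun py) i (proj₁ m) (proj₂ m) (B.2≤compM m (2≤fun px)))
    where m = fun-Matches (p , q)
  relabel-resp ≈-refl        = ≈-refl
  relabel-resp (≈-sym e)     = ≈-sym (relabel-resp e)
  relabel-resp (≈-trans d e) = ≈-trans (relabel-resp d) (relabel-resp e)
  relabel-resp (≈-graft {S} {S′} {T} {T′} i r d e) = subst₂ B._≈_
    (sym (relabel-graft S i T)) (sym (relabel-graft S′ i T′))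
    (≈-graft i (subst (i <_) (sym (arity-relabel S)) r) (relabel-resp d) (relabel-resp e))

  relabel-isEnvMorphism : IsEnvMorphism relabel
  relabel-isEnvMorphism = record
    { resp = relabel-resp
    ; pres-arity = arity-relabel
    ; pres-graft = λ S i _ T → B.≈-reflexive (relabel-graft S i T) }

  relabel-sendsCor : SendsCor φ relabel
  relabel-sendsCor x p p′ = B.≈-reflexive (relabel-Cor x p)

  -- Both maps respect grafting and agree on corollas, which generate; at `leaf` the arity leaves no
  -- choice.
  relabel-unique : ∀ (G : A.𝕋 → B.𝕋) → IsEnvMorphism G → SendsCor φ G → ∀ S → G S B.≈ relabel S
  relabel-unique G isG G-Cor = A.tree-induction (λ S → G S B.≈ relabel S)
    (B.≈-reflexive (B.arity-one (G leaf) (pres-arity leaf)))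
    (λ x p → ≈-trans (G-Cor x p (2≤fun p)) (≈-sym (relabel-sendsCor x p (2≤fun p))))
    (λ S i T r GS GT → ≈-trans (pres-graft S i r T)
      (≈-trans (≈-graft i (subst (i <_) (sym (pres-arity S)) r) GS GT)
               (B.≈-reflexive (sym (relabel-graft S i T)))))
    where open IsEnvMorphism isG

  -- Labels are lifted node by node with their arities, so even a strict preimage exists.
  relabel-surjective : SurjectiveMor φ → SurjectiveEnv relabel
  relabel-surjective sur T = proj₁ (lift T) , B.≈-reflexive (proj₂ (lift T))
    where
    mutual
      lift : ∀ T → Σ A.𝕋 λ S → relabel S ≡ T
      lift leaf = leaf , refl
      lift (node y p ts) with sur y
      ... | x , refl with lifts (fun-arity φ x) ts
      ... | us , e = node x (subst (2 ≤_) (fun-arity φ x) p) us , cong (node (fun φ x) _) e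

      lifts : ∀ {m n} (e : n ≡ m) (ts : Vec B.𝕋 n) → Σ (Vec A.𝕋 m) λ us → relabels (sym e) us ≡ ts
      lifts refl [] = [] , refl
      lifts refl (t ∷ ts) with lift t | lifts refl ts
      ... | u , e | us , es = u ∷ us , cong₂ _∷_ e es

  -- The action of a morphism on colours.

  -- φ need not fix colours, but it acts on them through the units, and compatibility of φ
  -- with composition by units makes it equivariant for that action.
  colour : Fin k → Fin k
  colour c = proj₁ (B.only-units _ (trans (fun-arity φ (A.unit c)) (A.unit-arity c)))

  fun-unit : ∀ c → fun φ (A.unit c) ≡ B.unit (colour c)
  fun-unit c = proj₂ (B.only-units _ (trans (fun-arity φ (A.unit c)) (A.unit-arity c)))

  inp-unit : ∀ {z c} p → z ≡ B.unit c → B.inp z 0 p ≡ c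
  inp-unit p refl = B.unit-inp _ p

  -- Composing the unit of colour `out y` with `y` is defined, hence so is the composition of the
  -- images; the image of the unit is the unit of the image colour.
  out-fun : ∀ y → B.out (fun φ y) ≡ colour (A.out y)
  out-fun y = trans
    (proj₂ (fun-Matches {A.unit c} {0} {y} (p , sym (A.unit-inp c p))))
    (inp-unit _ (fun-unit c))
    where
    c = A.out y
    p : 0 < A.arity (A.unit c)
    p = ≤-reflexive (sym (A.unit-arity c))

  -- The same argument with a unit composed into input `i`.
  inp-fun : ∀ x i p p′ → B.inp (fun φ x) i p′ ≡ colour (A.inp x i p)
  inp-fun x i p p′ = trans
    (sym (proj₁ (fun-comp φ x i p (A.unit c) (A.unit-out c) p′)))
    (trans (cong B.out (fun-unit c)) (B.unit-out _))
    where c = A.inp x i p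

  -- Injectivity by comparison of normal forms.

  module Injective (φ-inj : InjectiveMor φ) where
    colour-injective : ∀ c d → colour c ≡ colour d → c ≡ d
    colour-injective c d e = trans (sym (A.unit-out c)) (trans (cong A.out unit≡) (A.unit-out d))
      where
      unit≡ : A.unit c ≡ A.unit d
      unit≡ = φ-inj _ _ (trans (fun-unit c) (trans (cong B.unit e) (sym (fun-unit d))))

    -- A pair that does not match must not begin to match after relabelling; injectivity on colours
    -- excludes this.
    Matches-reflected : ∀ {x i y} → B.Matches (fun φ x) i (fun φ y) → A.Matches x i y
    Matches-reflected {x} {i} {y} (p′ , q′) = p , colour-injective _ _
      (trans (sym (out-fun y)) (trans q′ (inp-fun x i p p′)))
      where p = subst (i <_) (fun-arity φ x) p′

    relabelState : A.𝕊 → B.𝕊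
    relabelState (x , us) = fun φ x , mapRs (fun φ) us

    -- Both sides take the same decision because matches are preserved and reflected.
    plug-relabel : ∀ x i t → B.plug (fun φ x) i (mapR (fun φ) t) ≡ relabelState (A.plug x i t)
    plug-relabel x i tip = refl
    plug-relabel x i (branch y us) with A.matches? x i y
    ... | yes m = trans (B.plug-yes (fun-Matches m)) (cong (_, _) (sym (fun-compM m)))
    ... | no ¬m = B.plug-no (¬m ∘ Matches-reflected)

    absorb-relabel : ∀ o ts s → B.absorb o (mapRs (fun φ) ts) (relabelState s) ≡
                                relabelState (A.absorb o ts s)
    absorb-relabel o []       s = refl
    absorb-relabel o (t ∷ ts) s = begin
      B.step o (mapR (fun φ) t) (B.absorb (suc o) (mapRs (fun φ) ts) (relabelState s))
        ≡⟨ cong (B.step o (mapR (fun φ) t)) (absorb-relabel (suc o) ts s) ⟩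
      B.step o (mapR (fun φ) t) (relabelState (z , us))
        ≡⟨ cong (λ (w , vs) → w , vs ++ mapRs (fun φ) us) (plug-relabel z o t) ⟩
      fun φ (proj₁ (A.plug z o t)) , mapRs (fun φ) (proj₂ (A.plug z o t)) ++ mapRs (fun φ) us
        ≡⟨ cong (fun φ (proj₁ (A.plug z o t)) ,_) (sym (mapRs-++ (fun φ) (proj₂ (A.plug z o t)) us)) ⟩
      relabelState (A.step o t (z , us)) ∎
      where
      open ≡-Reasoning
      z  = proj₁ (A.absorb (suc o) ts s)
      us = proj₂ (A.absorb (suc o) ts s)

    mutual
      eval-relabel : ∀ S ρ → B.eval (relabel S) (mapR (fun φ) ∘ ρ) ≡ mapR (fun φ) (A.eval S ρ)
      eval-relabel leaf          ρ = refl
      eval-relabel (node x p ts) ρ = trans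
        (cong (B.construct (fun φ x)) (evals-relabel (sym (fun-arity φ x)) ts ρ))
        (cong B.toRose (absorb-relabel 0 (A.evals ts ρ) (x , [])))

      evals-relabel : ∀ {m n} .(e : m ≡ n) (ts : Vec A.𝕋 m) ρ →
                      B.evals (relabels e ts) (mapR (fun φ) ∘ ρ) ≡ mapRs (fun φ) (A.evals ts ρ)
      evals-relabel {n = zero}  e []       ρ = refl
      evals-relabel {n = suc n} e (t ∷ ts) ρ rewrite arity-relabel t =
        cong₂ _∷_ (eval-relabel t ρ) (evals-relabel _ ts (ρ ∘ (A.∣ t ∣ +_)))

    -- Congruent images have equal values, which are the relabelled values of `S` and `T`;
    -- injectivity on labels makes the latter equal, and values reflect congruence.
    relabel-injective : InjectiveEnv relabel
    relabel-injective S T e = A.eval-reflects S T (mapR-injective (fun φ) φ-inj _ _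
      (trans (sym (eval-relabel S _)) (trans (B.eval-resp e _) (eval-relabel T _))))

open Relabelling

-- Identities and composites of operad morphisms.

id-isEnvMorphism : ∀ {k} {C : ColouredOperad k} → IsEnvMorphism {C₁ = C} {C₂ = C} id
id-isEnvMorphism = record
  { resp = id ; pres-arity = λ _ → refl ; pres-graft = λ _ _ _ _ → ≈-refl }

∘-isEnvMorphism : ∀ {k} {C₁ C₂ C₃ : ColouredOperad k} {G : Tree C₂ → Tree C₃} {F : Tree C₁ → Tree C₂} →
                  IsEnvMorphism G → IsEnvMorphism F → IsEnvMorphism (G ∘ F)
∘-isEnvMorphism isG isF = record
  { resp = G.resp ∘ F.resp
  ; pres-arity = λ S → trans (G.pres-arity _) (F.pres-arity S)
  ; pres-graft = λ S i r T → ≈-trans (G.resp (F.pres-graft S i r T))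
      (G.pres-graft _ i (subst (i <_) (sym (F.pres-arity S)) r) _) }
  where
  module G = IsEnvMorphism isG
  module F = IsEnvMorphism isF

mainTheorem1 : (k : ℕ) → 1 ≤ k →
  Σ (∀ {C₁ C₂ : ColouredOperad k} → Morphism C₁ C₂ → Tree C₁ → Tree C₂) (λ E →
    -- E(φ) is an operad morphism sending [Cor x] to [Cor φ(x)], and it is the unique one
    (∀ (C₁ C₂ : ColouredOperad k) (φ : Morphism C₁ C₂) →
        IsEnvMorphism (E φ) × SendsCor φ (E φ)
      × (∀ (G : Tree C₁ → Tree C₂) → IsEnvMorphism G → SendsCor φ G →
           ∀ S → _≈E_ C₂ (G S) (E φ S)))
    -- functoriality
    × (∀ (C : ColouredOperad k) S → _≈E_ C (E (idMorphism C) S) S)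
    × (∀ (C₁ C₂ C₃ : ColouredOperad k) (φ : Morphism C₁ C₂) (ψ : Morphism C₂ C₃) S →
         _≈E_ C₃ (E (ψ ∘M φ) S) (E ψ (E φ S)))
    -- preservation of injectivity and surjectivity
    × (∀ (C₁ C₂ : ColouredOperad k) (φ : Morphism C₁ C₂) →
         InjectiveMor φ → InjectiveEnv (E φ))
    × (∀ (C₁ C₂ : ColouredOperad k) (φ : Morphism C₁ C₂) →
         SurjectiveMor φ → SurjectiveEnv (E φ)))
mainTheorem1 k _ = relabel
  , (λ C₁ C₂ φ → relabel-isEnvMorphism φ , relabel-sendsCor φ , relabel-unique φ)
  -- Functoriality follows from uniqueness: the identity, and next the composite, is an operad
  -- morphism with the required values on corollas.
  , (λ C S → ≈-sym (relabel-unique (idMorphism C) id id-isEnvMorphism (λ _ _ _ → ≈-refl) S))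
  , (λ C₁ C₂ C₃ φ ψ S → ≈-sym (relabel-unique (ψ ∘M φ) (relabel ψ ∘ relabel φ)
      (∘-isEnvMorphism (relabel-isEnvMorphism ψ) (relabel-isEnvMorphism φ))
      (λ x p p′ → ≈-trans
        (relabel-resp ψ (relabel-sendsCor φ x p (2≤fun φ p)))
        (relabel-sendsCor ψ (fun φ x) (2≤fun φ p) p′))
      S))
  , (λ C₁ C₂ φ → Injective.relabel-injective φ)
  , (λ C₁ C₂ φ → relabel-surjective φ)
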